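{- Let $(M,\le,\circ,e,\rightharpoonup,\leftharpoonup)$ be a biclosed poset. Then: (1) $\mathsf{Dial}_M(\mathsf{Set})$ is a category. (2) The tensor product $\otimes$ is a bifunctor on it, and together with the unit $I=(\mathbb{1},\mathbb{1},e)$ (where $\mathbb{1}$ is a one-element set) and suitable associator and left/right unitor isomorphisms it makes $\mathsf{Dial}_M(\mathsf{Set})$ a (generally non-symmetric) monoidal category. (3) For all objects $A,B,C$ there are bijections, natural in $A,B,C$, $$\mathrm{Hom}(A\otimes B,C)\cong \mathrm{Hom}(B,A\rightharpoonup C),\qquad \mathrm{Hom}(A\otimes B,C)\cong \mathrm{Hom}(A,C\leftharpoonup B).$$ That is, $\mathsf{Dial}_M(\mathsf{Set})$ is monoidal biclosed.
   Context: A biclosed poset $(M,\le,\circ,e,\rightharpoonup,\leftharpoonup)$ is a partially ordered monoid $(M,\le,\circ,e)$, not necessarily commutative, with $\circ$ monotone in each argument, such that for all $a,b\in M$ the following exist: - $a\rightharpoonup b$, the largest $x\in M$ with $a\circ x\le b$; - $b\leftharpoonup a$, the largest $x\in M$ with $x\circ a\le b$. The category $\mathsf{Dial}_M(\mathsf{Set})$ of dialectica Lambek spaces is defined as follows. - Objects are triples $(U,X,\alpha)$ with $U,X$ sets and $\alpha:U\times X\to M$ a function. - A morphism $(f,F):(U,X,\alpha)\to(V,Y,\beta)$ is a pair of functions $f:U\to V$ and $F:Y\to X$ such that $\alpha(u,F(y))\le\beta(f(u),y)$ for all $u\in U$ and $y\in Y$. - Composition is $(g,G)\circ(f,F)=(g\circ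 f,\;F\circ G)$, and identities are $(\mathrm{id},\mathrm{id})$. Tensor product: $(U,X,\alpha)\otimes(V,Y,\beta)=(U\times V,\;(V\to X)\times(U\to Y),\;\alpha\otimes\beta)$, where $$(\alpha\otimes\beta)((u,v),(h,k))=\alpha(u,h(v))\circ\beta(k(u),v).$$ Here $S\to T$ denotes the set of all functions from $S$ to $T$. On morphisms $(f,F):(U,X,\alpha)\to(U',X',\alpha')$ and $(g,G):(V,Y,\beta)\to(V',Y',\beta')$, the tensor is $$(f,F)\otimes(g,G)=\big(f\times g,\;(h,k)\mapsto(F\circ h\circ g,\;G\circ k\circ f)\big).$$ Internal homs: for $A=(U,X,\alpha)$ and $C=(V,Y,\beta)$, $$A\rightharpoonup C=\big((U\to V)\times(Y\to X),\;U\times Y,\;\alpha\rightharpoonup\beta\big),\qquad (\alpha\rightharpoonup\beta)((h,H),(u,y))=\alpha(u,H(y))\rightharpoonup\beta(h(u),y),$$ $$C\leftharpoonup A=\big((U\to V)\times(Y\to X),\;U\times Y,\;\beta\leftharpoonup\alpha\big),\qquad (\beta\leftharpoonup\alpha)((h,H),(u,y))=\beta(h(u),y)\leftharpoonup\alpha(u,H(y)).$$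
   Formalization: In the tensor product, the printed term β(k(u),v) is ill-typed, since β is defined on V×Y while k(u) lies in Y and v in V; it is read as β(v,k(u)). -}

module Defs where

open import Level using (Level; _⊔_; suc)
open import Algebra.Structures using (IsMonoid)
open import Data.Product using (_×_; _,_; proj₁; proj₂)
open import Data.Product.Function.NonDependent.Setoid using (_×-function_)
open import Data.Product.Relation.Binary.Pointwise.NonDependent using (_×ₛ_)
open import Data.Unit.Polymorphic.Properties using () renaming (≡-setoid to ⊤-setoid)
open import Function.Bundles using (Func; Inverse; _⟨$⟩_)
import Function.Construct.Composition as Composition
import Function.Construct.Identity as Identity
open import Function.Relation.Binary.Setoid.Equality using (_⇨_)
open import Relation.Binary.Bundles using (Poset; Setoid)
open import Relation.Binary.Core using (Rel)
open import Relation.Binary.Structures using (IsEquivalence; IsPartialOrder)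

private
  variable
    a b c ℓ ℓ₁ ℓ₂ o o′ e e′ ℓ′ : Level

record RawCategory o ℓ e : Set (suc (o ⊔ ℓ ⊔ e)) where
  infix  4 _≈_ _⇒_
  infixr 9 _∘_
  field
    Obj : Set o
    _⇒_ : Obj → Obj → Set ℓ
    _≈_ : ∀ {A B} → Rel (A ⇒ B) e
    id  : ∀ {A} → A ⇒ A
    _∘_ : ∀ {A B C} → B ⇒ C → A ⇒ B → A ⇒ C

record IsCategory (𝒞 : RawCategory o ℓ e) : Set (o ⊔ ℓ ⊔ e) where
  open RawCategory 𝒞
  field
    isEquivalence : ∀ {A B} → IsEquivalence (_≈_ {A} {B})
    ∘-resp-≈      : ∀ {A B C} {f f′ : B ⇒ C} {g g′ : A ⇒ B} →
                    f ≈ f′ → g ≈ g′ → f ∘ g ≈ f′ ∘ g′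
    identityˡ     : ∀ {A B} (f : A ⇒ B) → id ∘ f ≈ f
    identityʳ     : ∀ {A B} (f : A ⇒ B) → f ∘ id ≈ f
    assoc         : ∀ {A B C D} (h : C ⇒ D) (g : B ⇒ C) (f : A ⇒ B) →
                    (h ∘ g) ∘ f ≈ h ∘ (g ∘ f)

  Hom : Obj → Obj → Setoid ℓ e
  Hom A B = record { isEquivalence = isEquivalence {A} {B} }

op : RawCategory o ℓ e → RawCategory o ℓ e
op 𝒞 = record
  { Obj = Obj
  ; _⇒_ = λ A B → B ⇒ A
  ; _≈_ = _≈_
  ; id  = id
  ; _∘_ = λ f g → g ∘ f
  } where open RawCategory 𝒞

infixr 2 _×ᶜ_
_×ᶜ_ : RawCategory o ℓ e → RawCategory o′ ℓ′ e′ →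
       RawCategory (o ⊔ o′) (ℓ ⊔ ℓ′) (e ⊔ e′)
𝒞 ×ᶜ 𝒟 = record
  { Obj = C.Obj × D.Obj
  ; _⇒_ = λ A B → (proj₁ A C.⇒ proj₁ B) × (proj₂ A D.⇒ proj₂ B)
  ; _≈_ = λ f g → (proj₁ f C.≈ proj₁ g) × (proj₂ f D.≈ proj₂ g)
  ; id  = C.id , D.id
  ; _∘_ = λ g f → (proj₁ g C.∘ proj₁ f) , (proj₂ g D.∘ proj₂ f)
  } where
    module C = RawCategory 𝒞
    module D = RawCategory 𝒟

record RawFunctor (𝒞 : RawCategory o ℓ e) (𝒟 : RawCategory o′ ℓ′ e′)
       : Set (o ⊔ ℓ ⊔ o′ ⊔ ℓ′) where
  private
    module C = RawCategory 𝒞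
    module D = RawCategory 𝒟
  field
    F₀ : C.Obj → D.Obj
    F₁ : ∀ {A B} → A C.⇒ B → F₀ A D.⇒ F₀ B

record IsFunctor {𝒞 : RawCategory o ℓ e} {𝒟 : RawCategory o′ ℓ′ e′}
                 (F : RawFunctor 𝒞 𝒟) : Set (o ⊔ ℓ ⊔ e ⊔ e′) where
  private
    module C = RawCategory 𝒞
    module D = RawCategory 𝒟
  open RawFunctor F
  field
    F-resp-≈     : ∀ {A B} {f g : A C.⇒ B} → f C.≈ g → F₁ f D.≈ F₁ g
    identity     : ∀ {A} → F₁ (C.id {A}) D.≈ D.id
    homomorphism : ∀ {A B C} (g : B C.⇒ C) (f : A C.⇒ B) →
                   F₁ (g C.∘ f) D.≈ F₁ g D.∘ F₁ f

record Iso (𝒞 : RawCategory o ℓ e)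
           (A B : RawCategory.Obj 𝒞) : Set (ℓ ⊔ e) where
  open RawCategory 𝒞
  field
    from : A ⇒ B
    to   : B ⇒ A
    isoˡ : to ∘ from ≈ id
    isoʳ : from ∘ to ≈ id

module _ {𝒞 : RawCategory o ℓ e} (⊗ : RawFunctor (𝒞 ×ᶜ 𝒞) 𝒞) where
  open RawCategory 𝒞
  private
    infixr 10 _⊗₀_ _⊗₁_

    _⊗₀_ : Obj → Obj → Obj
    A ⊗₀ B = RawFunctor.F₀ ⊗ (A , B)

    _⊗₁_ : ∀ {A A′ B B′} → A ⇒ A′ → B ⇒ B′ → A ⊗₀ B ⇒ A′ ⊗₀ B′
    f ⊗₁ g = RawFunctor.F₁ ⊗ (f , g)

  record MonoidalStructure (I : Obj) : Set (o ⊔ ℓ ⊔ e) where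
    field
      associator : ∀ A B C → Iso 𝒞 ((A ⊗₀ B) ⊗₀ C) (A ⊗₀ (B ⊗₀ C))
      unitorˡ    : ∀ A → Iso 𝒞 (I ⊗₀ A) A
      unitorʳ    : ∀ A → Iso 𝒞 (A ⊗₀ I) A

    α⇒ : ∀ A B C → (A ⊗₀ B) ⊗₀ C ⇒ A ⊗₀ (B ⊗₀ C)
    α⇒ A B C = Iso.from (associator A B C)

    λ⇒ : ∀ A → I ⊗₀ A ⇒ A
    λ⇒ A = Iso.from (unitorˡ A)

    ρ⇒ : ∀ A → A ⊗₀ I ⇒ A
    ρ⇒ A = Iso.from (unitorʳ A)

    field
      associator-natural :
        ∀ {A A′ B B′ C C′} (f : A ⇒ A′) (g : B ⇒ B′) (h : C ⇒ C′) →
        α⇒ A′ B′ C′ ∘ ((f ⊗₁ g) ⊗₁ h) ≈ (f ⊗₁ (g ⊗₁ h)) ∘ α⇒ A B C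
      unitorˡ-natural :
        ∀ {A A′} (f : A ⇒ A′) → λ⇒ A′ ∘ (id ⊗₁ f) ≈ f ∘ λ⇒ A
      unitorʳ-natural :
        ∀ {A A′} (f : A ⇒ A′) → ρ⇒ A′ ∘ (f ⊗₁ id) ≈ f ∘ ρ⇒ A
      triangle :
        ∀ A B → (id {A} ⊗₁ λ⇒ B) ∘ α⇒ A I B ≈ ρ⇒ A ⊗₁ id {B}
      pentagon :
        ∀ A B C D →
        (id {A} ⊗₁ α⇒ B C D) ∘ α⇒ A (B ⊗₀ C) D ∘ (α⇒ A B C ⊗₁ id {D})
          ≈ α⇒ A B (C ⊗₀ D) ∘ α⇒ (A ⊗₀ B) C D

  record Symmetry {I : Obj} (monoidal : MonoidalStructure I)
                  : Set (o ⊔ ℓ ⊔ e) where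
    open MonoidalStructure monoidal
    field
      σ         : ∀ A B → A ⊗₀ B ⇒ B ⊗₀ A
      σ-natural : ∀ {A A′ B B′} (f : A ⇒ A′) (g : B ⇒ B′) →
                  σ A′ B′ ∘ (f ⊗₁ g) ≈ (g ⊗₁ f) ∘ σ A B
      σ-inverse : ∀ A B → σ B A ∘ σ A B ≈ id
      hexagon   : ∀ A B C →
                  (id {B} ⊗₁ σ A C) ∘ α⇒ B A C ∘ (σ A B ⊗₁ id {C})
                    ≈ α⇒ B C A ∘ σ A (B ⊗₀ C) ∘ α⇒ A B C

  -- Naturality in the three variables is expressed by a single square, for
  -- simultaneous morphisms A′ ⇒ A, B′ ⇒ B and C ⇒ C′.

  record NaturalBijection-⇀ (isCategory : IsCategory 𝒞)
         (⇀ : RawFunctor (op 𝒞 ×ᶜ 𝒞) 𝒞) : Set (o ⊔ ℓ ⊔ e) where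
    open IsCategory isCategory using (Hom)
    open RawFunctor ⇀ renaming (F₀ to ⇀₀; F₁ to ⇀₁)
    field
      bijection : ∀ A B C → Inverse (Hom (A ⊗₀ B) C) (Hom B (⇀₀ (A , C)))
      natural   :
        ∀ {A A′ B B′ C C′} (f : A′ ⇒ A) (g : B′ ⇒ B) (h : C ⇒ C′)
        (φ : A ⊗₀ B ⇒ C) →
        Inverse.to (bijection A′ B′ C′) (h ∘ φ ∘ (f ⊗₁ g))
          ≈ ⇀₁ (f , h) ∘ Inverse.to (bijection A B C) φ ∘ g

  record NaturalBijection-↼ (isCategory : IsCategory 𝒞)
         (↼ : RawFunctor (𝒞 ×ᶜ op 𝒞) 𝒞) : Set (o ⊔ ℓ ⊔ e) where
    open IsCategory isCategory using (Hom)
    open RawFunctor ↼ renaming (F₀ to ↼₀; F₁ to ↼₁)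
    field
      bijection : ∀ A B C → Inverse (Hom (A ⊗₀ B) C) (Hom A (↼₀ (C , B)))
      natural   :
        ∀ {A A′ B B′ C C′} (f : A′ ⇒ A) (g : B′ ⇒ B) (h : C ⇒ C′)
        (φ : A ⊗₀ B ⇒ C) →
        Inverse.to (bijection A′ B′ C′) (h ∘ φ ∘ (f ⊗₁ g))
          ≈ ↼₁ (h , g) ∘ Inverse.to (bijection A B C) φ ∘ f

IsLargest : {A : Set a} → Rel A ℓ → (A → Set b) → A → Set (a ⊔ ℓ ⊔ b)
IsLargest _≤_ P x = P x × (∀ y → P y → y ≤ x)

record BiclosedPoset c ℓ₁ ℓ₂ : Set (suc (c ⊔ ℓ₁ ⊔ ℓ₂)) where
  infix  4 _≈_ _≤_
  infixl 7 _∙_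
  infix  6 _⇀_ _↼_
  field
    Carrier        : Set c
    _≈_            : Rel Carrier ℓ₁
    _≤_            : Rel Carrier ℓ₂
    _∙_            : Carrier → Carrier → Carrier
    unit           : Carrier
    _⇀_            : Carrier → Carrier → Carrier
    _↼_            : Carrier → Carrier → Carrier
    isPartialOrder : IsPartialOrder _≈_ _≤_
    isMonoid       : IsMonoid _≈_ _∙_ unit
    ∙-monoˡ-≤      : ∀ {a b} c → a ≤ b → a ∙ c ≤ b ∙ c
    ∙-monoʳ-≤      : ∀ {a b} c → a ≤ b → c ∙ a ≤ c ∙ b
    ⇀-largest      : ∀ a b → IsLargest _≤_ (λ x → a ∙ x ≤ b) (a ⇀ b)
    ↼-largest      : ∀ a b → IsLargest _≤_ (λ x → x ∙ a ≤ b) (b ↼ a)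

  poset : Poset c ℓ₁ ℓ₂
  poset = record { isPartialOrder = isPartialOrder }

  open Poset poset public
    using (module Eq; antisym)
    renaming (refl to ≤-refl; reflexive to ≤-reflexive; trans to ≤-trans)

  open IsMonoid isMonoid public using (∙-cong; assoc; identityˡ; identityʳ)

  setoid : Setoid c ℓ₁
  setoid = record { isEquivalence = Eq.isEquivalence }

  ⇀-mono : ∀ {a a′ b b′} → a′ ≤ a → b ≤ b′ → a ⇀ b ≤ a′ ⇀ b′
  ⇀-mono {a} {a′} {b} {b′} a′≤a b≤b′ =
    proj₂ (⇀-largest a′ b′) (a ⇀ b)
      (≤-trans (∙-monoˡ-≤ _ a′≤a) (≤-trans (proj₁ (⇀-largest a b)) b≤b′))

  ↼-mono : ∀ {a a′ b b′} → b ≤ b′ → a′ ≤ a → b ↼ a ≤ b′ ↼ a′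
  ↼-mono {a} {a′} {b} {b′} b≤b′ a′≤a =
    proj₂ (↼-largest a′ b′) (b ↼ a)
      (≤-trans (∙-monoʳ-≤ _ a′≤a) (≤-trans (proj₁ (↼-largest a b)) b≤b′))

  ⇀-cong : ∀ {a a′ b b′} → a ≈ a′ → b ≈ b′ → a ⇀ b ≈ a′ ⇀ b′
  ⇀-cong a≈a′ b≈b′ = antisym
    (⇀-mono (≤-reflexive (Eq.sym a≈a′)) (≤-reflexive b≈b′))
    (⇀-mono (≤-reflexive a≈a′) (≤-reflexive (Eq.sym b≈b′)))

  ↼-cong : ∀ {a a′ b b′} → b ≈ b′ → a ≈ a′ → b ↼ a ≈ b′ ↼ a′
  ↼-cong b≈b′ a≈a′ = antisym
    (↼-mono (≤-reflexive b≈b′) (≤-reflexive (Eq.sym a≈a′)))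
    (↼-mono (≤-reflexive (Eq.sym b≈b′)) (≤-reflexive a≈a′))

infixr 9 _∘ₛ_
_∘ₛ_ : {A : Setoid a ℓ} {B : Setoid b ℓ₁} {C : Setoid c ℓ₂} →
       Func B C → Func A B → Func A C
g ∘ₛ f = Composition.function f g

-- f ⇨₁ g is the function h ↦ g ∘ h ∘ f.
infixr 9 _⇨₁_
_⇨₁_ : {A A′ : Setoid a ℓ} {B B′ : Setoid b ℓ₁} →
       Func A′ A → Func B B′ → Func (A ⇨ B) (A′ ⇨ B′)
f ⇨₁ g = record
  { to   = λ h → g ∘ₛ h ∘ₛ f
  ; cong = λ h≈h′ x → Func.cong g (h≈h′ (f ⟨$⟩ x))
  }

-- Sets are rendered as setoids and functions as equality-preserving maps, so
-- that S ⇨ T, the set of functions S → T, has extensional equality.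
module _ (M : BiclosedPoset c ℓ₁ ℓ₂) (s : Level) where
  private module M = BiclosedPoset M
  open M using (_≤_; _∙_)

  record DialObj : Set (c ⊔ ℓ₁ ⊔ suc s) where
    constructor ⟪_,_,_⟫
    field
      pos : Setoid s s
      neg : Setoid s s
      rel : Func (pos ×ₛ neg) M.setoid

  record DialHom (A B : DialObj) : Set (ℓ₂ ⊔ s) where
    private
      module A = DialObj A
      module B = DialObj B
    field
      fwd : Func A.pos B.pos
      bwd : Func B.neg A.neg
      fwd-bwd-≤ : ∀ u y → A.rel ⟨$⟩ (u , bwd ⟨$⟩ y) ≤ B.rel ⟨$⟩ (fwd ⟨$⟩ u , y)

  open DialHom

  Dial : RawCategory (c ⊔ ℓ₁ ⊔ suc s) (ℓ₂ ⊔ s) s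
  Dial = record
    { Obj = DialObj
    ; _⇒_ = DialHom
    ; _≈_ = λ {A} {B} φ ψ →
        Setoid._≈_ (DialObj.pos A ⇨ DialObj.pos B) (fwd φ) (fwd ψ) ×
        Setoid._≈_ (DialObj.neg B ⇨ DialObj.neg A) (bwd φ) (bwd ψ)
    ; id  = record
        { fwd       = Identity.function _
        ; bwd       = Identity.function _
        ; fwd-bwd-≤ = λ _ _ → M.≤-refl
        }
    ; _∘_ = λ ψ φ → record
        { fwd       = fwd ψ ∘ₛ fwd φ
        ; bwd       = bwd φ ∘ₛ bwd ψ
        ; fwd-bwd-≤ = λ u z → M.≤-trans
            (fwd-bwd-≤ φ u (bwd ψ ⟨$⟩ z)) (fwd-bwd-≤ ψ (fwd φ ⟨$⟩ u) z)
        }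
    }

  tensor : RawFunctor (Dial ×ᶜ Dial) Dial
  tensor = record { F₀ = tensor₀ ; F₁ = tensor₁ }
    where
    tensor₀ : DialObj × DialObj → DialObj
    tensor₀ (⟪ U , X , α ⟫ , ⟪ V , Y , β ⟫) =
      ⟪ U ×ₛ V
      , (V ⇨ X) ×ₛ (U ⇨ Y)
      , record
          { to   = λ { ((u , v) , (h , k)) →
                       (α ⟨$⟩ (u , h ⟨$⟩ v)) ∙ (β ⟨$⟩ (v , k ⟨$⟩ u)) }
          ; cong = λ { {(u , v) , (h , k)} {(u′ , v′) , (h′ , k′)}
                       ((u≈u′ , v≈v′) , (h≈h′ , k≈k′)) → M.∙-cong
                       (Func.cong α (u≈u′ , Setoid.trans X (h≈h′ v) (Func.cong h′ v≈v′)))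
                       (Func.cong β (v≈v′ , Setoid.trans Y (k≈k′ u) (Func.cong k′ u≈u′))) }
          }
      ⟫

    tensor₁ : ∀ {A B} → RawCategory._⇒_ (Dial ×ᶜ Dial) A B →
              DialHom (tensor₀ A) (tensor₀ B)
    tensor₁ (φ , ψ) = record
      { fwd       = fwd φ ×-function fwd ψ
      ; bwd       = (fwd ψ ⇨₁ bwd φ) ×-function (fwd φ ⇨₁ bwd ψ)
      ; fwd-bwd-≤ = λ { (u , v) (h , k) → M.≤-trans
          (M.∙-monoˡ-≤ _ (fwd-bwd-≤ φ u (h ⟨$⟩ (fwd ψ ⟨$⟩ v))))
          (M.∙-monoʳ-≤ _ (fwd-bwd-≤ ψ v (k ⟨$⟩ (fwd φ ⟨$⟩ u)))) }
      }

  tensorUnit : DialObj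
  tensorUnit =
    ⟪ ⊤-setoid s
    , ⊤-setoid s
    , record { to = λ _ → M.unit ; cong = λ _ → M.Eq.refl }
    ⟫

  -- On morphisms (f , F) : A′ → A and (g , G) : C → C′, both internal homs act
  -- by (h , H) ↦ (g ∘ h ∘ f , F ∘ H ∘ G) and (u , y) ↦ (f u , G y).

  rightHom : RawFunctor (op Dial ×ᶜ Dial) Dial
  rightHom = record { F₀ = hom₀ ; F₁ = hom₁ }
    where
    hom₀ : DialObj × DialObj → DialObj
    hom₀ (⟪ U , X , α ⟫ , ⟪ V , Y , β ⟫) =
      ⟪ (U ⇨ V) ×ₛ (Y ⇨ X)
      , U ×ₛ Y
      , record
          { to   = λ { ((h , H) , (u , y)) →
                       (α ⟨$⟩ (u , H ⟨$⟩ y)) M.⇀ (β ⟨$⟩ (h ⟨$⟩ u , y)) }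
          ; cong = λ { {(h , H) , (u , y)} {(h′ , H′) , (u′ , y′)}
                       ((h≈h′ , H≈H′) , (u≈u′ , y≈y′)) → M.⇀-cong
                       (Func.cong α (u≈u′ , Setoid.trans X (H≈H′ y) (Func.cong H′ y≈y′)))
                       (Func.cong β (Setoid.trans V (h≈h′ u) (Func.cong h′ u≈u′) , y≈y′)) }
          }
      ⟫

    hom₁ : ∀ {A B} → RawCategory._⇒_ (op Dial ×ᶜ Dial) A B →
           DialHom (hom₀ A) (hom₀ B)
    hom₁ (φ , ψ) = record
      { fwd       = (fwd φ ⇨₁ fwd ψ) ×-function (bwd ψ ⇨₁ bwd φ)
      ; bwd       = fwd φ ×-function bwd ψ
      ; fwd-bwd-≤ = λ { (h , H) (u , y) → M.⇀-mono
          (fwd-bwd-≤ φ u (H ⟨$⟩ (bwd ψ ⟨$⟩ y)))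
          (fwd-bwd-≤ ψ (h ⟨$⟩ (fwd φ ⟨$⟩ u)) y) }
      }

  leftHom : RawFunctor (Dial ×ᶜ op Dial) Dial
  leftHom = record { F₀ = hom₀ ; F₁ = hom₁ }
    where
    hom₀ : DialObj × DialObj → DialObj
    hom₀ (⟪ V , Y , β ⟫ , ⟪ U , X , α ⟫) =
      ⟪ (U ⇨ V) ×ₛ (Y ⇨ X)
      , U ×ₛ Y
      , record
          { to   = λ { ((h , H) , (u , y)) →
                       (β ⟨$⟩ (h ⟨$⟩ u , y)) M.↼ (α ⟨$⟩ (u , H ⟨$⟩ y)) }
          ; cong = λ { {(h , H) , (u , y)} {(h′ , H′) , (u′ , y′)}
                       ((h≈h′ , H≈H′) , (u≈u′ , y≈y′)) → M.↼-cong
                       (Func.cong β (Setoid.trans V (h≈h′ u) (Func.cong h′ u≈u′) , y≈y′))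
                       (Func.cong α (u≈u′ , Setoid.trans X (H≈H′ y) (Func.cong H′ y≈y′))) }
          }
      ⟫

    hom₁ : ∀ {A B} → RawCategory._⇒_ (Dial ×ᶜ op Dial) A B →
           DialHom (hom₀ A) (hom₀ B)
    hom₁ (ψ , φ) = record
      { fwd       = (fwd φ ⇨₁ fwd ψ) ×-function (bwd ψ ⇨₁ bwd φ)
      ; bwd       = fwd φ ×-function bwd ψ
      ; fwd-bwd-≤ = λ { (h , H) (u , y) → M.↼-mono
          (fwd-bwd-≤ ψ (h ⟨$⟩ (fwd φ ⟨$⟩ u)) y)
          (fwd-bwd-≤ φ u (H ⟨$⟩ (bwd ψ ⟨$⟩ y))) }
      }

{-# OPTIONS --safe #-}

-- All coherence equations hold on the nose for the underlying functions, and
-- the remaining inequalities are associativity, the unit laws and residuation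
-- in M.  Residuation turns currying into both adjunctions: a map
-- F : Z → (V → X) × (U → Y) carries the same data as V → (Z → X) together
-- with U × Z → Y.  A symmetry on objects (𝟙, 𝟙, a) and (𝟙, 𝟙, b) forces
-- a ∙ b ≤ b ∙ a, which fails in a four-element residuated chain.

module Submission where

open import Defs
open import Level using (Level; 0ℓ)
open import Data.Fin using (Fin; _≤_)
open import Data.Fin.Patterns using (0F; 1F; 2F; 3F)
open import Data.Fin.Properties using (_≟_; _≤?_; all?; ≤-isPartialOrder)
open import Data.Product using (_×_; _,_; proj₁; proj₂; Σ-syntax)
open import Data.Product.Function.NonDependent.Setoid using (proj₁ₛ; proj₂ₛ; <_,_>ₛ)
open import Data.Product.Relation.Binary.Pointwise.NonDependent using (_×ₛ_)
open import Data.Unit.Polymorphic using (tt)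
open import Data.Unit.Polymorphic.Properties using () renaming (≡-setoid to ⊤-setoid)
open import Function.Bundles using (Func; _⟨$⟩_)
import Function.Construct.Constant as Constant
open import Function.Relation.Binary.Setoid.Equality using (_⇨_)
open import Relation.Binary.Bundles using (Setoid)
import Relation.Binary.Construct.On as On
open import Relation.Binary.PropositionalEquality using (_≡_; refl; cong₂; isEquivalence)
open import Relation.Nullary using (¬_)
open import Relation.Nullary.Decidable using (from-yes; from-no; _→-dec_; _×-dec_)

private
  variable
    a b c ℓ ℓ₁ ℓ₂ : Level

-- Currying, flipping and congruence for setoid functions.

module _ {A : Setoid a ℓ} {B : Setoid b ℓ₁} {C : Setoid c ℓ₂} where

  curryₛ : Func (A ×ₛ B) C → Func A (B ⇨ C)
  curryₛ f = record
    { to   = λ x → record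
        { to   = λ y → f ⟨$⟩ (x , y)
        ; cong = λ y≈y′ → Func.cong f (Setoid.refl A , y≈y′)
        }
    ; cong = λ x≈x′ y → Func.cong f (x≈x′ , Setoid.refl B)
    }

  uncurryₛ : Func A (B ⇨ C) → Func (A ×ₛ B) C
  uncurryₛ f = record
    { to   = λ p → (f ⟨$⟩ proj₁ p) ⟨$⟩ proj₂ p
    ; cong = λ {p} {q} p≈q → Setoid.trans C
        (Func.cong f (proj₁ p≈q) (proj₂ p)) (Func.cong (f ⟨$⟩ proj₁ q) (proj₂ p≈q))
    }

  flipₛ : Func A (B ⇨ C) → Func B (A ⇨ C)
  flipₛ f = record
    { to   = λ y → record
        { to   = λ x → (f ⟨$⟩ x) ⟨$⟩ y
        ; cong = λ x≈x′ → Func.cong f x≈x′ y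
        }
    ; cong = λ y≈y′ x → Func.cong (f ⟨$⟩ x) y≈y′
    }

  ∘ₛ-cong : {g g′ : Func B C} {f f′ : Func A B} →
            Setoid._≈_ (B ⇨ C) g g′ → Setoid._≈_ (A ⇨ B) f f′ →
            Setoid._≈_ (A ⇨ C) (g ∘ₛ f) (g′ ∘ₛ f′)
  ∘ₛ-cong {g′ = g′} {f = f} g≈g′ f≈f′ x =
    Setoid.trans C (g≈g′ (f ⟨$⟩ x)) (Func.cong g′ (f≈f′ x))

-- The tensor and both internal homs act on their function-space components through `_⇨₁_`, so this
-- single congruence serves `F-resp-≈` for all three functors.
⇨₁-cong : {A A′ : Setoid a ℓ} {B B′ : Setoid b ℓ₁} {f f′ : Func A′ A} {g g′ : Func B B′} →
          Setoid._≈_ (A′ ⇨ A) f f′ → Setoid._≈_ (B ⇨ B′) g g′ →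
          Setoid._≈_ ((A ⇨ B) ⇨ (A′ ⇨ B′)) (f ⇨₁ g) (f′ ⇨₁ g′)
⇨₁-cong {B′ = B′} {f = f} {g′ = g′} f≈f′ g≈g′ h x =
  Setoid.trans B′ (g≈g′ (h ⟨$⟩ (f ⟨$⟩ x))) (Func.cong g′ (Func.cong h (f≈f′ x)))

-- The category of dialectica spaces and its three bifunctors.

module _ (M : BiclosedPoset c ℓ₁ ℓ₂) (s : Level) where
  private
    module M = BiclosedPoset M
  open RawCategory (Dial M s)
  open DialObj
  open DialHom

  private
    infixr 10 _⊗₀_ _⊗₁_
    infix 10 _⇀₀_ _↼₀_

    _⊗₀_ : Obj → Obj → Obj
    A ⊗₀ B = RawFunctor.F₀ (tensor M s) (A , B)

    _⊗₁_ : ∀ {A A′ B B′} → A ⇒ A′ → B ⇒ B′ → A ⊗₀ B ⇒ A′ ⊗₀ B′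
    f ⊗₁ g = RawFunctor.F₁ (tensor M s) (f , g)

    _⇀₀_ : Obj → Obj → Obj
    A ⇀₀ C = RawFunctor.F₀ (rightHom M s) (A , C)

    _↼₀_ : Obj → Obj → Obj
    C ↼₀ A = RawFunctor.F₀ (leftHom M s) (C , A)

    I : Obj
    I = tensorUnit M s

    -- Morphism equality unfolds to pointwise equality of the underlying functions. Sides that
    -- compute to the same functions, up to eta for pairs and for the one-element set, are therefore
    -- equated by reflexivity at either of them. The morphism is explicit because unification cannot
    -- recover it from the unfolded equality.
    ≈-refl-on : ∀ {A B} (φ : A ⇒ B) → φ ≈ φ
    ≈-refl-on {A} {B} φ = (λ _ → Setoid.refl (pos B)) , (λ _ → Setoid.refl (neg A))

  Dial-isCategory : IsCategory (Dial M s)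
  Dial-isCategory = record
    { isEquivalence = λ {A} {B} → On.isEquivalence (λ φ → fwd φ , bwd φ)
        (Setoid.isEquivalence ((pos A ⇨ pos B) ×ₛ (neg B ⇨ neg A)))
    ; ∘-resp-≈      = λ {A} {B} {C} {f} {f′} {g} {g′} f≈f′ g≈g′ →
        ∘ₛ-cong {g = fwd f} {fwd f′} {fwd g} {fwd g′} (proj₁ f≈f′) (proj₁ g≈g′) ,
        ∘ₛ-cong {g = bwd g} {bwd g′} {bwd f} {bwd f′} (proj₂ g≈g′) (proj₂ f≈f′)
    ; identityˡ     = ≈-refl-on
    ; identityʳ     = ≈-refl-on
    ; assoc         = λ h g f → ≈-refl-on (h ∘ g ∘ f)
    }

  tensor-isFunctor : IsFunctor (tensor M s)
  tensor-isFunctor = record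
    { F-resp-≈     = λ { {f = φ , ψ} {φ′ , ψ′} ((f≈f′ , F≈F′) , (g≈g′ , G≈G′)) →
        (λ (u , v) → f≈f′ u , g≈g′ v) ,
        (λ (h , k) →
          ⇨₁-cong {f = fwd ψ} {fwd ψ′} {bwd φ} {bwd φ′} g≈g′ F≈F′ h ,
          ⇨₁-cong {f = fwd φ} {fwd φ′} {bwd ψ} {bwd ψ′} f≈f′ G≈G′ k) }
    ; identity     = λ { {A , B} → ≈-refl-on (id {A ⊗₀ B}) }
    ; homomorphism = λ g f → ≈-refl-on (RawFunctor.F₁ (tensor M s) g ∘ RawFunctor.F₁ (tensor M s) f)
    }

  rightHom-isFunctor : IsFunctor (rightHom M s)
  rightHom-isFunctor = record
    { F-resp-≈     = λ { {f = φ , ψ} {φ′ , ψ′} ((f≈f′ , F≈F′) , (g≈g′ , G≈G′)) →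
        (λ (h , H) →
          ⇨₁-cong {f = fwd φ} {fwd φ′} {fwd ψ} {fwd ψ′} f≈f′ g≈g′ h ,
          ⇨₁-cong {f = bwd ψ} {bwd ψ′} {bwd φ} {bwd φ′} G≈G′ F≈F′ H) ,
        (λ (u , y) → f≈f′ u , G≈G′ y) }
    ; identity     = λ { {A , C} → ≈-refl-on (id {A ⇀₀ C}) }
    ; homomorphism = λ g f → ≈-refl-on (RawFunctor.F₁ (rightHom M s) g ∘ RawFunctor.F₁ (rightHom M s) f)
    }

  leftHom-isFunctor : IsFunctor (leftHom M s)
  leftHom-isFunctor = record
    { F-resp-≈     = λ { {f = ψ , φ} {ψ′ , φ′} ((g≈g′ , G≈G′) , (f≈f′ , F≈F′)) →
        (λ (h , H) →
          ⇨₁-cong {f = fwd φ} {fwd φ′} {fwd ψ} {fwd ψ′} f≈f′ g≈g′ h ,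
          ⇨₁-cong {f = bwd ψ} {bwd ψ′} {bwd φ} {bwd φ′} G≈G′ F≈F′ H) ,
        (λ (u , y) → f≈f′ u , G≈G′ y) }
    ; identity     = λ { {C , A} → ≈-refl-on (id {C ↼₀ A}) }
    ; homomorphism = λ g f → ≈-refl-on (RawFunctor.F₁ (leftHom M s) g ∘ RawFunctor.F₁ (leftHom M s) f)
    }

  -- The monoidal structure.

  -- Write U, V, W for the positive and X, Y, Z for the negative parts of `A`, `B`, `C`. Under
  -- either bracketing the negative part amounts to three functions V × W → X, U × W → Y and U × V →
  -- Z, one per factor and depending on the other two positions. The backward maps only re-curry
  -- this triple, which leaves associativity in `M` as the inequality.
  tensor-associator : ∀ A B C → Iso (Dial M s) ((A ⊗₀ B) ⊗₀ C) (A ⊗₀ (B ⊗₀ C))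
  tensor-associator A B C = record
    { from = record
        { fwd       = < proj₁ₛ ∘ₛ proj₁ₛ , < proj₂ₛ ∘ₛ proj₁ₛ , proj₂ₛ >ₛ >ₛ
        ; bwd       = record
            { to   = λ (h , k) →
                < flipₛ (curryₛ h) , flipₛ (proj₁ₛ ∘ₛ k) >ₛ , uncurryₛ (proj₂ₛ ∘ₛ k)
            ; cong = λ (h≈h′ , k≈k′) →
                (λ w → (λ v → h≈h′ (v , w)) , (λ u → proj₁ (k≈k′ u) w)) ,
                (λ (u , v) → proj₂ (k≈k′ u) v)
            }
        ; fwd-bwd-≤ = λ _ _ → M.≤-reflexive (M.assoc _ _ _)
        }
    ; to   = record
        { fwd       = < < proj₁ₛ , proj₁ₛ ∘ₛ proj₂ₛ >ₛ , proj₂ₛ ∘ₛ proj₂ₛ >ₛ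
        ; bwd       = record
            { to   = λ (h , k) →
                uncurryₛ (flipₛ (proj₁ₛ ∘ₛ h)) , < flipₛ (proj₂ₛ ∘ₛ h) , curryₛ k >ₛ
            ; cong = λ (h≈h′ , k≈k′) →
                (λ (v , w) → proj₁ (h≈h′ w) v) ,
                (λ u → (λ w → proj₂ (h≈h′ w) u) , (λ v → k≈k′ (u , v)))
            }
        ; fwd-bwd-≤ = λ _ _ → M.≤-reflexive (M.Eq.sym (M.assoc _ _ _))
        }
    ; isoˡ = ≈-refl-on (id {(A ⊗₀ B) ⊗₀ C})
    ; isoʳ = ≈-refl-on (id {A ⊗₀ (B ⊗₀ C)})
    }

  -- The negative part of `I ⊗₀ A` is (U → 𝟙) × (𝟙 → X): the first factor is trivial and the second
  -- is X by evaluation at `tt`. Eta for 𝟙 makes both round trips hold by computation.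
  tensor-unitorˡ : ∀ A → Iso (Dial M s) (I ⊗₀ A) A
  tensor-unitorˡ A = record
    { from = record
        { fwd       = proj₂ₛ
        ; bwd       = record
            { to   = λ x → Constant.function (pos A) (⊤-setoid s) tt ,
                           Constant.function (⊤-setoid s) (neg A) x
            ; cong = λ x≈x′ → (λ _ → refl) , (λ _ → x≈x′)
            }
        ; fwd-bwd-≤ = λ _ _ → M.≤-reflexive (M.identityˡ _)
        }
    ; to   = record
        { fwd       = record { to = λ u → tt , u ; cong = λ u≈u′ → refl , u≈u′ }
        ; bwd       = record { to = λ (_ , k) → k ⟨$⟩ tt ; cong = λ (_ , k≈k′) → k≈k′ tt }
        ; fwd-bwd-≤ = λ _ _ → M.≤-reflexive (M.Eq.sym (M.identityˡ _))
        }
    ; isoˡ = ≈-refl-on (id {I ⊗₀ A})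
    ; isoʳ = ≈-refl-on (id {A})
    }

  tensor-unitorʳ : ∀ A → Iso (Dial M s) (A ⊗₀ I) A
  tensor-unitorʳ A = record
    { from = record
        { fwd       = proj₁ₛ
        ; bwd       = record
            { to   = λ x → Constant.function (⊤-setoid s) (neg A) x ,
                           Constant.function (pos A) (⊤-setoid s) tt
            ; cong = λ x≈x′ → (λ _ → x≈x′) , (λ _ → refl)
            }
        ; fwd-bwd-≤ = λ _ _ → M.≤-reflexive (M.identityʳ _)
        }
    ; to   = record
        { fwd       = record { to = λ u → u , tt ; cong = λ u≈u′ → u≈u′ , refl }
        ; bwd       = record { to = λ (h , _) → h ⟨$⟩ tt ; cong = λ (h≈h′ , _) → h≈h′ tt }
        ; fwd-bwd-≤ = λ _ _ → M.≤-reflexive (M.Eq.sym (M.identityʳ _))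
        }
    ; isoˡ = ≈-refl-on (id {A ⊗₀ I})
    ; isoʳ = ≈-refl-on (id {A})
    }

  tensor-monoidal : MonoidalStructure (tensor M s) I
  tensor-monoidal = record
    { associator         = tensor-associator
    ; unitorˡ            = tensor-unitorˡ
    ; unitorʳ            = tensor-unitorʳ
    ; associator-natural = λ {A} {A′} {B} {B′} {C} {C′} f g h →
        ≈-refl-on ((f ⊗₁ (g ⊗₁ h)) ∘ Iso.from (tensor-associator A B C))
    ; unitorˡ-natural    = λ {A} {A′} f → ≈-refl-on (f ∘ Iso.from (tensor-unitorˡ A))
    ; unitorʳ-natural    = λ {A} {A′} f → ≈-refl-on (f ∘ Iso.from (tensor-unitorʳ A))
    ; triangle           = λ A B → ≈-refl-on (Iso.from (tensor-unitorʳ A) ⊗₁ id {B})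
    -- Both composites regroup the same four functions, each taking the positions of the other three
    -- factors, so they agree by computation.
    ; pentagon           = λ A B C D → ≈-refl-on
        (Iso.from (tensor-associator A B (C ⊗₀ D)) ∘ Iso.from (tensor-associator (A ⊗₀ B) C D))
    }

  -- Residuation and the two tensor-hom adjunctions.

  ⇀-residual : ∀ {a b x} → a M.∙ x M.≤ b → x M.≤ a M.⇀ b
  ⇀-residual = proj₂ (M.⇀-largest _ _) _

  ⇀-residual⁻¹ : ∀ {a b x} → x M.≤ a M.⇀ b → a M.∙ x M.≤ b
  ⇀-residual⁻¹ x≤a⇀b = M.≤-trans (M.∙-monoʳ-≤ _ x≤a⇀b) (proj₁ (M.⇀-largest _ _))

  ↼-residual : ∀ {a b x} → x M.∙ a M.≤ b → x M.≤ b M.↼ a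
  ↼-residual = proj₂ (M.↼-largest _ _) _

  ↼-residual⁻¹ : ∀ {a b x} → x M.≤ b M.↼ a → x M.∙ a M.≤ b
  ↼-residual⁻¹ x≤b↼a = M.≤-trans (M.∙-monoˡ-≤ _ x≤b↼a) (proj₁ (M.↼-largest _ _))

  module _ (A B C : Obj) where

    -- The component of `bwd φ` valued in `neg A` joins the forward map, and the one valued in
    -- `neg B` becomes the backward map. Since `A` is the left factor, its value in `M` is moved
    -- across by `⇀`.
    curryʳ : A ⊗₀ B ⇒ C → B ⇒ A ⇀₀ C
    curryʳ φ = record
      { fwd       = < flipₛ (curryₛ (fwd φ)) , flipₛ (proj₁ₛ ∘ₛ bwd φ) >ₛ
      ; bwd       = uncurryₛ (flipₛ (proj₂ₛ ∘ₛ bwd φ))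
      ; fwd-bwd-≤ = λ v (u , z) → ⇀-residual (fwd-bwd-≤ φ (u , v) z)
      }

    uncurryʳ : B ⇒ A ⇀₀ C → A ⊗₀ B ⇒ C
    uncurryʳ ψ = record
      { fwd       = uncurryₛ (flipₛ (proj₁ₛ ∘ₛ fwd ψ))
      ; bwd       = < flipₛ (proj₂ₛ ∘ₛ fwd ψ) , flipₛ (curryₛ (bwd ψ)) >ₛ
      ; fwd-bwd-≤ = λ (u , v) z → ⇀-residual⁻¹ (fwd-bwd-≤ ψ v (u , z))
      }

    -- The mirror image: now the component valued in `neg B` joins the forward map, and the value of
    -- the right factor `B` is moved across by `↼`.
    curryˡ : A ⊗₀ B ⇒ C → A ⇒ C ↼₀ B
    curryˡ φ = record
      { fwd       = < curryₛ (fwd φ) , flipₛ (proj₂ₛ ∘ₛ bwd φ) >ₛ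
      ; bwd       = uncurryₛ (flipₛ (proj₁ₛ ∘ₛ bwd φ))
      ; fwd-bwd-≤ = λ u (v , z) → ↼-residual (fwd-bwd-≤ φ (u , v) z)
      }

    uncurryˡ : A ⇒ C ↼₀ B → A ⊗₀ B ⇒ C
    uncurryˡ ψ = record
      { fwd       = uncurryₛ (proj₁ₛ ∘ₛ fwd ψ)
      ; bwd       = < flipₛ (curryₛ (bwd ψ)) , flipₛ (proj₂ₛ ∘ₛ fwd ψ) >ₛ
      ; fwd-bwd-≤ = λ (u , v) z → ↼-residual⁻¹ (fwd-bwd-≤ ψ u (v , z))
      }

    curryʳ-cong : ∀ {φ φ′} → φ ≈ φ′ → curryʳ φ ≈ curryʳ φ′
    curryʳ-cong (f≈f′ , F≈F′) =
      (λ v → (λ u → f≈f′ (u , v)) , (λ z → proj₁ (F≈F′ z) v)) ,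
      (λ (u , z) → proj₂ (F≈F′ z) u)

    uncurryʳ-cong : ∀ {ψ ψ′} → ψ ≈ ψ′ → uncurryʳ ψ ≈ uncurryʳ ψ′
    uncurryʳ-cong (g≈g′ , G≈G′) =
      (λ (u , v) → proj₁ (g≈g′ v) u) ,
      (λ z → (λ v → proj₂ (g≈g′ v) z) , (λ u → G≈G′ (u , z)))

    curryˡ-cong : ∀ {φ φ′} → φ ≈ φ′ → curryˡ φ ≈ curryˡ φ′
    curryˡ-cong (f≈f′ , F≈F′) =
      (λ u → (λ v → f≈f′ (u , v)) , (λ z → proj₂ (F≈F′ z) u)) ,
      (λ (v , z) → proj₁ (F≈F′ z) v)

    uncurryˡ-cong : ∀ {ψ ψ′} → ψ ≈ ψ′ → uncurryˡ ψ ≈ uncurryˡ ψ′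
    uncurryˡ-cong (g≈g′ , G≈G′) =
      (λ (u , v) → proj₁ (g≈g′ u) v) ,
      (λ z → (λ v → G≈G′ (v , z)) , (λ u → proj₂ (g≈g′ u) z))

  rightHom-bijection : NaturalBijection-⇀ (tensor M s) Dial-isCategory (rightHom M s)
  rightHom-bijection = record
    { bijection = λ A B C → record
        { to        = curryʳ A B C
        ; from      = uncurryʳ A B C
        ; to-cong   = λ {φ} {φ′} → curryʳ-cong A B C {φ = φ} {φ′}
        ; from-cong = λ {ψ} {ψ′} → uncurryʳ-cong A B C {ψ = ψ} {ψ′}
        -- The first half asks that φ ≈ uncurry ψ imply curry φ ≈ ψ. Since curry (uncurry ψ) is
        -- pointwise ψ by computation, congruence of currying already has this type; the second half
        -- is dual.
        ; inverse   = (λ {ψ} {φ} → curryʳ-cong A B C {φ = φ} {uncurryʳ A B C ψ}) ,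
                      (λ {φ} {ψ} → uncurryʳ-cong A B C {ψ = ψ} {curryʳ A B C φ})
        }
    ; natural   = λ {A} {_} {B} {_} {C} f g h φ →
        ≈-refl-on (RawFunctor.F₁ (rightHom M s) (f , h) ∘ curryʳ A B C φ ∘ g)
    }

  leftHom-bijection : NaturalBijection-↼ (tensor M s) Dial-isCategory (leftHom M s)
  leftHom-bijection = record
    { bijection = λ A B C → record
        { to        = curryˡ A B C
        ; from      = uncurryˡ A B C
        ; to-cong   = λ {φ} {φ′} → curryˡ-cong A B C {φ = φ} {φ′}
        ; from-cong = λ {ψ} {ψ′} → uncurryˡ-cong A B C {ψ = ψ} {ψ′}
        ; inverse   = (λ {ψ} {φ} → curryˡ-cong A B C {φ = φ} {uncurryˡ A B C ψ}) ,
                      (λ {φ} {ψ} → uncurryˡ-cong A B C {ψ = ψ} {curryˡ A B C φ})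
        }
    ; natural   = λ {A} {_} {B} {_} {C} f g h φ →
        ≈-refl-on (RawFunctor.F₁ (leftHom M s) (h , g) ∘ curryˡ A B C φ ∘ f)
    }

  -- Failure of symmetry.

  constantObj : M.Carrier → Obj
  constantObj a =
    ⟪ ⊤-setoid s , ⊤-setoid s , record { to = λ _ → a ; cong = λ _ → M.Eq.refl } ⟫

  -- The tensor of the constant objects at `a` and `b` has relation constantly `a ∙ b`, so the
  -- inequality carried by the braiding, read at any point, is the claim.
  symmetry⇒∙-comm-≤ : {monoidal : MonoidalStructure (tensor M s) I} →
                      Symmetry (tensor M s) monoidal → ∀ a b → a M.∙ b M.≤ b M.∙ a
  symmetry⇒∙-comm-≤ symmetry a b =
    fwd-bwd-≤ (Symmetry.σ symmetry (constantObj a) (constantObj b)) (tt , tt) (const-tt , const-tt)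
    where
    const-tt : Func (⊤-setoid s) (⊤-setoid s)
    const-tt = Constant.function _ _ tt

-- The chain 0 < x < e < y, where 0 is absorbing, e is the unit and {x , y} is
-- a left-zero band.  The unit must lie between x and y for the product to be
-- monotone.

module LeftZeroChain where

  infixl 7 _∙_
  _∙_ : Fin 4 → Fin 4 → Fin 4
  0F ∙ _  = 0F
  2F ∙ q  = q
  _  ∙ 0F = 0F
  p  ∙ _  = p

  infix 6 _⇀_ _↼_
  -- If `p` is not the unit `2F`, then `p ∙ r` is `p` for every nonzero `r`. Hence `p ⇀ q` is the
  -- top `3F` when `p ≤ q` and `0F` otherwise.
  _⇀_ : Fin 4 → Fin 4 → Fin 4
  0F ⇀ _  = 3F
  1F ⇀ 0F = 0F
  1F ⇀ _  = 3F
  2F ⇀ q  = q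
  3F ⇀ 3F = 3F
  3F ⇀ _  = 0F

  -- Right multiplication by `1F` sends 0, 1, 2, 3 to 0, 1, 1, 3, and by `3F` to 0, 1, 3, 3; the
  -- values are read off from these two rows.
  _↼_ : Fin 4 → Fin 4 → Fin 4
  _  ↼ 0F = 3F
  0F ↼ 1F = 0F
  3F ↼ 1F = 3F
  _  ↼ 1F = 2F
  q  ↼ 2F = q
  0F ↼ 3F = 0F
  3F ↼ 3F = 3F
  _  ↼ 3F = 1F

  leftZeroChain : BiclosedPoset 0ℓ 0ℓ 0ℓ
  leftZeroChain = record
    { Carrier        = Fin 4
    ; _≈_            = _≡_
    ; _≤_            = _≤_
    ; _∙_            = _∙_
    ; unit           = 2F
    ; _⇀_            = _⇀_
    ; _↼_            = _↼_
    ; isPartialOrder = ≤-isPartialOrder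
    ; isMonoid       = record
        { isSemigroup = record
            { isMagma = record { isEquivalence = isEquivalence ; ∙-cong = cong₂ _∙_ }
            ; assoc   = from-yes (all? λ p → all? λ q → all? λ r → (p ∙ q) ∙ r ≟ p ∙ (q ∙ r))
            }
        ; identity    = (λ _ → refl) , from-yes (all? λ p → p ∙ 2F ≟ p)
        }
    -- The decision procedure runs on the closed, fully quantified statement, so that it evaluates;
    -- its result is then instantiated.
    ; ∙-monoˡ-≤      = λ {p} {q} r → from-yes
        (all? λ p → all? λ q → all? λ r → (p ≤? q) →-dec (p ∙ r ≤? q ∙ r)) p q r
    ; ∙-monoʳ-≤      = λ {p} {q} r → from-yes
        (all? λ p → all? λ q → all? λ r → (p ≤? q) →-dec (r ∙ p ≤? r ∙ q)) p q r
    ; ⇀-largest      = from-yes (all? λ p → all? λ q →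
        (p ∙ (p ⇀ q) ≤? q) ×-dec all? λ r → (p ∙ r ≤? q) →-dec (r ≤? p ⇀ q))
    ; ↼-largest      = from-yes (all? λ p → all? λ q →
        ((q ↼ p) ∙ p ≤? q) ×-dec all? λ r → (r ∙ p ≤? q) →-dec (r ≤? q ↼ p))
    }

  -- In the left-zero band the products are the left factors, here `3F` and `1F`.
  ∙-not-comm-≤ : ¬ 3F ∙ 1F ≤ 1F ∙ 3F
  ∙-not-comm-≤ = from-no (3F ∙ 1F ≤? 1F ∙ 3F)

open LeftZeroChain using (leftZeroChain; ∙-not-comm-≤)

theorem1 : ∀ {c ℓ₁ ℓ₂ : Level} (s : Level) →
    ((M : BiclosedPoset c ℓ₁ ℓ₂) →
    Σ[ isCategory ∈ IsCategory (Dial M s) ]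
    (IsFunctor (tensor M s) × MonoidalStructure (tensor M s) (tensorUnit M s)) ×
    (IsFunctor (rightHom M s) × NaturalBijection-⇀ (tensor M s) isCategory (rightHom M s)) ×
    (IsFunctor (leftHom M s) × NaturalBijection-↼ (tensor M s) isCategory (leftHom M s)))
    ×
    (Σ[ M ∈ BiclosedPoset 0ℓ 0ℓ 0ℓ ]
    ((monoidal : MonoidalStructure (tensor M s) (tensorUnit M s)) →
    ¬ Symmetry (tensor M s) monoidal))
theorem1 s =
  (λ M → Dial-isCategory M s ,
    (tensor-isFunctor M s , tensor-monoidal M s) ,
    (rightHom-isFunctor M s , rightHom-bijection M s) ,
    (leftHom-isFunctor M s , leftHom-bijection M s)) ,
  (leftZeroChain , λ monoidal symmetry →
    ∙-not-comm-≤ (symmetry⇒∙-comm-≤ leftZeroChain s symmetry 3F 1F))
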